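{- Let $H$ be a finite simple graph whose vertex set can be partitioned into anticliques (independent sets) of sizes $x_1,x_2,\ldots,x_k$. Then $$\rho(H) \geq \sum_{i=1}^k \frac{x_i(x_i + 1)}{2}.$$
   Context: All graphs are finite and simple. A coloring means a proper vertex coloring; an induced subgraph is rainbow if all its vertices have pairwise different colors. For a graph $H$, $\rho(H)$ is the least number $m$ such that there exists a graph $G$ on $m$ vertices such that every proper vertex coloring of $G$ contains a rainbow induced subgraph isomorphic to $H$. An anticlique is a set of pairwise non-adjacent vertices. -}

module Defs where

open import Level using (0ℓ)
open import Data.Bool using (Bool; true; false; T; _∧_; _∨_)
open import Data.Bool.Properties using (T?) renaming (_≟_ to _≟ᵇ_)
open import Data.Empty using (⊥-elim)
open import Data.Fin using (Fin; zero; suc; toℕ; combine; remQuot)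
open import Data.Fin.Properties
  using (_≟_; any?; all?; pigeonhole; remQuot-combine; toℕ-injective; <⇒≢)
open import Data.Fin.Subset using (Subset; _∈_)
open import Data.Nat as ℕ using (ℕ; zero; suc; _≤_; _<_; s≤s)
import Data.Nat.Properties as ℕ
open import Data.Product using (Σ; ∃; ∃!; _×_; _,_; proj₁; proj₂)
open import Data.Sum using (_⊎_; inj₁; inj₂)
open import Data.Vec using (tabulate)
open import Data.Vec.Functional using (head; tail) renaming (_∷_ to _∷ᶠ_)
open import Data.Vec.Properties using (lookup∘tabulate; []=⇒lookup; lookup⇒[]=)
open import Data.Vec.Properties.WithK using ([]=-irrelevant)
open import Function using (_∘_; _↔_; _⇔_; mk⇔; mk↔ₛ′; Inverse; Equivalence)
open import Relation.Binary
  using (Rel; Reflexive; Symmetric; Irreflexive; _Respects_)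
open import Relation.Binary.PropositionalEquality
  using (_≡_; _≢_; _≗_; refl; sym; trans; cong; cong₂; subst; subst₂)
open import Relation.Nullary
  using (¬_; Dec; yes; no; does; ¬?; contradiction; _×-dec_; _→-dec_)
open import Relation.Nullary.Decidable
  using (map′; decidable-stable; dec-true; ⌊_⌋)
open import Relation.Unary using (Pred; Decidable)

private
  variable
    k l m n : ℕ
    A V W : Set

------------------------------------------------------------------------
-- Finite simple graphs

-- Adjacency is Boolean because a finite graph has a decidable edge relation.
-- Finite graphs are taken on vertex sets Fin n; other vertex types only arise
-- for induced subgraphs.

record Graph (V : Set) : Set where
  field
    adj : V → V → Bool

  infix 4 _~_
  _~_ : Rel V 0ℓ
  u ~ v = T (adj u v)

  field
    ~-sym    : Symmetric _~_
    ~-irrefl : Irreflexive _≡_ _~_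

infix 4 _≅_

_≅_ : Graph V → Graph W → Set
_≅_ {V} {W} G H = Σ (V ↔ W) λ e →
  ∀ u v → (u G.~ v) ⇔ (Inverse.to e u H.~ Inverse.to e v)
  where
  module G = Graph G
  module H = Graph H

infix 8 _[_]

_[_] : Graph (Fin m) → (S : Subset m) → Graph (∃ λ v → v ∈ S)
G [ S ] = record
  { adj      = λ (u , _) (v , _) → adj u v
  ; ~-sym    = ~-sym
  ; ~-irrefl = ~-irrefl ∘ cong proj₁
  }
  where open Graph G

Anticlique : Graph (Fin m) → Subset m → Set
Anticlique G S = ∀ {u v} → u ∈ S → v ∈ S → ¬ (u ~ v)
  where open Graph G

-- Pairwise disjoint sets covering everything.  Empty parts are allowed.

Partition : (Fin k → Subset n) → Set
Partition P = ∀ v → ∃! _≡_ λ i → v ∈ P i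

------------------------------------------------------------------------
-- Colorings and ρ

-- A finite graph uses finitely many colors, so ℕ serves as the color set.

Proper : Graph V → (V → ℕ) → Set
Proper G c = ∀ {u v} → u ~ v → c u ≢ c v
  where open Graph G

Rainbow : (Fin m → ℕ) → Subset m → Set
Rainbow c S = ∀ {u v} → u ∈ S → v ∈ S → u ≢ v → c u ≢ c v

Forces : Graph (Fin m) → Graph (Fin n) → Set
Forces G H = ∀ c → Proper G c → ∃ λ S → Rainbow c S × G [ S ] ≅ H

ForcedOn : Graph (Fin n) → ℕ → Set
ForcedOn H m = Σ (Graph (Fin m)) λ G → Forces G H

Least : Pred ℕ 0ℓ → ℕ → Set
Least P m = P m × (∀ j → P j → m ≤ j)

-- The minimum exists: ForcedOn H is decidable and holds at n * n.  Both facts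
-- are easier to see with an induced copy given as a map Fin n → Fin m rather
-- than as a subset; injectivity of the map follows from the rainbow condition.

Copy : Graph (Fin n) → (Fin m → Fin m → Bool) → (Fin m → A) → (Fin n → Fin m) → Set
Copy H a c f = (∀ u v → u ≢ v → c (f u) ≢ c (f v))
             × (∀ u v → Graph.adj H u v ≡ a (f u) (f v))

private
  T-ext : ∀ {a b} → (T a → T b) → (T b → T a) → a ≡ b
  T-ext {false} {false} _ _ = refl
  T-ext {false} {true}  _ g = ⊥-elim (g _)
  T-ext {true}  {false} f _ = ⊥-elim (f _)
  T-ext {true}  {true}  _ _ = refl

module _ (H : Graph (Fin n)) (G : Graph (Fin m)) (c : Fin m → ℕ) where

  private
    module G = Graph G
    module H = Graph H

  copy⇒subset : ∃ (Copy H G.adj c) → ∃ λ S → Rainbow c S × G [ S ] ≅ H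
  copy⇒subset (f , rain , iso) = S , rainbow , e , λ u v → mk⇔ (to u v) (from u v)
    where
    inImage? : ∀ v → Dec (∃ λ u → f u ≡ v)
    inImage? v = any? λ u → f u ≟ v

    S : Subset m
    S = tabulate (does ∘ inImage?)

    ∈⇒ : ∀ {v} → v ∈ S → ∃ λ u → f u ≡ v
    ∈⇒ {v} v∈S with inImage? v | trans (sym (lookup∘tabulate (does ∘ inImage?) v)) ([]=⇒lookup v∈S)
    ... | yes p | _ = p

    ⇒∈ : ∀ u → f u ∈ S
    ⇒∈ u = lookup⇒[]= (f u) S
      (trans (lookup∘tabulate (does ∘ inImage?) (f u)) (dec-true (inImage? (f u)) (u , refl)))

    f-inj : ∀ {u v} → f u ≡ f v → u ≡ v
    f-inj {u} {v} eq = decidable-stable (u ≟ v) λ u≢v → rain u v u≢v (cong c eq)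

    rainbow : Rainbow c S
    rainbow u∈S v∈S u≢v with ∈⇒ u∈S | ∈⇒ v∈S
    ... | x , refl | y , refl = rain x y (u≢v ∘ cong f)

    pre : (∃ λ v → v ∈ S) → Fin n
    pre (_ , v∈S) = proj₁ (∈⇒ v∈S)

    f-pre : ∀ v → f (pre v) ≡ proj₁ v
    f-pre (_ , v∈S) = proj₂ (∈⇒ v∈S)

    ∈-ext : {p q : ∃ λ v → v ∈ S} → proj₁ p ≡ proj₁ q → p ≡ q
    ∈-ext refl = cong (_ ,_) ([]=-irrelevant _ _)

    e : (∃ λ v → v ∈ S) ↔ Fin n
    e = mk↔ₛ′ pre (λ u → f u , ⇒∈ u) (λ u → f-inj (f-pre (f u , ⇒∈ u))) (λ v → ∈-ext (f-pre v))

    adj-pre : ∀ u v → H.adj (pre u) (pre v) ≡ G.adj (proj₁ u) (proj₁ v)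
    adj-pre u v = trans (iso _ _) (cong₂ G.adj (f-pre u) (f-pre v))

    to : ∀ u v → proj₁ u G.~ proj₁ v → pre u H.~ pre v
    to u v = subst T (sym (adj-pre u v))

    from : ∀ u v → pre u H.~ pre v → proj₁ u G.~ proj₁ v
    from u v = subst T (adj-pre u v)

  subset⇒copy : (∃ λ S → Rainbow c S × G [ S ] ≅ H) → ∃ (Copy H G.adj c)
  subset⇒copy (S , rain , e , iso) = f , rain′ , λ u v → T-ext (to u v) (from u v)
    where
    open Inverse e using (strictlyInverseˡ) renaming (to to φ; from to ψ)

    f : Fin n → Fin m
    f = proj₁ ∘ ψ

    f-inj : ∀ {u v} → f u ≡ f v → u ≡ v
    f-inj {u} {v} eq =
      trans (sym (strictlyInverseˡ u)) (trans (cong φ (∈-ext eq)) (strictlyInverseˡ v))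
      where
      ∈-ext : {p q : ∃ λ v → v ∈ S} → proj₁ p ≡ proj₁ q → p ≡ q
      ∈-ext refl = cong (_ ,_) ([]=-irrelevant _ _)

    rain′ : ∀ u v → u ≢ v → c (f u) ≢ c (f v)
    rain′ u v u≢v = rain (proj₂ (ψ u)) (proj₂ (ψ v)) (u≢v ∘ f-inj)

    to : ∀ u v → u H.~ v → f u G.~ f v
    to u v = Equivalence.from (iso (ψ u) (ψ v))
           ∘ subst₂ H._~_ (sym (strictlyInverseˡ u)) (sym (strictlyInverseˡ v))

    from : ∀ u v → f u G.~ f v → u H.~ v
    from u v = subst₂ H._~_ (strictlyInverseˡ u) (strictlyInverseˡ v)
             ∘ Equivalence.to (iso (ψ u) (ψ v))

------------------------------------------------------------------------
-- Decidability of ForcedOn H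

private

  -- Without function extensionality, finite function spaces can only be
  -- searched for predicates that respect pointwise equality.

  Search : (A : Set) → Rel A 0ℓ → Set₁
  Search A _≈_ = ∀ {P : Pred A 0ℓ} → P Respects _≈_ → Decidable P → Dec (∃ P)

  Pointwise : Rel A 0ℓ → Rel (Fin n → A) 0ℓ
  Pointwise _≈_ f g = ∀ i → f i ≈ g i

  search-Bool : Search Bool _≡_
  search-Bool _ P? with P? false | P? true
  ... | yes p | _     = yes (false , p)
  ... | no _  | yes p = yes (true , p)
  ... | no ¬p | no ¬q = no λ { (false , p) → ¬p p ; (true , q) → ¬q q }

  search-Fin→ : ∀ {_≈_ : Rel A 0ℓ} → Reflexive _≈_ → Search A _≈_ →
                ∀ n → Search (Fin n → A) (Pointwise _≈_)
  search-Fin→ _ _ zero resp P? =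
    map′ (_ ,_) (λ (_ , p) → resp (λ ()) p) (P? λ ())
  search-Fin→ ≈-refl s (suc n) {P} resp P? =
    map′ (λ (a , f , p) → a ∷ᶠ f , p)
         (λ (f , p) → head f , tail f , resp (λ { zero → ≈-refl ; (suc _) → ≈-refl }) p)
         (s (λ a≈b (f , p) → f , resp (λ { zero → a≈b ; (suc _) → ≈-refl }) p)
            (λ a → search-Fin→ ≈-refl s n
                     (λ f≈g → resp λ { zero → ≈-refl ; (suc i) → f≈g i })
                     (λ f → P? (a ∷ᶠ f))))

  search-map : Search (Fin n → Fin m) (Pointwise _≡_)
  search-map = search-Fin→ {_≈_ = _≡_} refl (λ _ → any?) _

  forall? : {_≈_ : Rel A 0ℓ} → Symmetric _≈_ → Search A _≈_ →
            {P : Pred A 0ℓ} → P Respects _≈_ → Decidable P → Dec (∀ a → P a)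
  forall? ≈-sym s resp P? =
    map′ (λ ¬∃¬ a → decidable-stable (P? a) λ ¬p → ¬∃¬ (a , ¬p))
         (λ p (a , ¬p) → ¬p (p a))
         (¬? (s (λ a≈b ¬p p → ¬p (resp (≈-sym a≈b) p)) (¬? ∘ P?)))

  Copy? : (H : Graph (Fin n)) (a : Fin m → Fin m → Bool) (c : Fin m → Fin k) → Decidable (Copy H a c)
  Copy? H a c f =
    (all? λ u → all? λ v → ¬? (u ≟ v) →-dec ¬? (c (f u) ≟ c (f v)))
    ×-dec (all? λ u → all? λ v → Graph.adj H u v ≟ᵇ a (f u) (f v))

  Copy-resp : (H : Graph (Fin n)) {a b : Fin m → Fin m → Bool} {c d : Fin m → A} {f g : Fin n → Fin m} →
              (∀ u v → a u v ≡ b u v) → c ≗ d → f ≗ g → Copy H a c f → Copy H b d g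
  Copy-resp H {a} {b} {c} {d} {f} {g} a≈b c≈d f≈g (rain , iso) =
    (λ u v u≢v eq → rain u v u≢v (trans (cf u) (trans eq (sym (cf v))))) ,
    (λ u v → trans (iso u v) (trans (cong₂ a (f≈g u) (f≈g v)) (a≈b _ _)))
    where
    cf : ∀ u → c (f u) ≡ d (g u)
    cf u = trans (cong c (f≈g u)) (c≈d _)

  FinProper : (Fin m → Fin m → Bool) → (Fin m → A) → Set
  FinProper a c = ∀ u v → T (a u v) → c u ≢ c v

  -- m colors suffice on m vertices.

  Forces′ : (Fin m → Fin m → Bool) → Graph (Fin n) → Set
  Forces′ {m} a H = ∀ (c : Fin m → Fin m) → FinProper a c → ∃ (Copy H a c)

  Forces′-resp : (H : Graph (Fin n)) {a b : Fin m → Fin m → Bool} →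
                 (∀ u v → a u v ≡ b u v) → Forces′ a H → Forces′ b H
  Forces′-resp H {a} {b} a≈b forces c proper
    with f , copy ← forces c (λ u v → proper u v ∘ subst T (a≈b u v))
    = f , Copy-resp H {a} {b} {c} a≈b (λ _ → refl) (λ _ → refl) copy

  Forces′? : (a : Fin m → Fin m → Bool) (H : Graph (Fin n)) → Dec (Forces′ a H)
  Forces′? a H = forall? (λ p i → sym (p i)) search-map
    (λ {c} {d} c≈d q proper →
      let f , copy = q (λ u v e eq → proper u v e (trans (sym (c≈d u)) (trans eq (c≈d v))))
      in f , Copy-resp H {a} {a} {c} {d} (λ _ _ → refl) c≈d (λ _ → refl) copy)
    (λ c → (all? λ u → all? λ v → T? (a u v) →-dec ¬? (c u ≟ c v))
           →-dec search-map (λ f≈g → Copy-resp H {a} {a} {c} {c} (λ _ _ → refl) (λ _ → refl) f≈g)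
                   (Copy? H a c))

  least-index : (c : Fin (suc m) → ℕ) → ℕ → Fin (suc m)
  least-index {m} c x with any? (λ u → c u ℕ.≟ x)
  ... | yes (u , _) = u
  ... | no  _       = zero

  least-index-spec : (c : Fin (suc m) → ℕ) → ∀ v → c (least-index c (c v)) ≡ c v
  least-index-spec c v with any? (λ u → c u ℕ.≟ c v)
  ... | yes (_ , eq) = eq
  ... | no  ¬p       = contradiction (v , refl) ¬p

  compress : (c : Fin m → ℕ) → Σ (Fin m → Fin m) λ d → ∀ u v → (c u ≡ c v) ⇔ (d u ≡ d v)
  compress {zero}  c = (λ ()) , λ ()
  compress {suc m} c = least-index c ∘ c , λ u v → mk⇔ (cong (least-index c))
    λ eq → trans (sym (least-index-spec c u)) (trans (cong c eq) (least-index-spec c v))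

  Forces⇒ : (G : Graph (Fin m)) (H : Graph (Fin n)) → Forces G H → Forces′ (Graph.adj G) H
  Forces⇒ G H forces c proper
    with f , rain , iso ← subset⇒copy H G (toℕ ∘ c)
                            (forces (toℕ ∘ c) (λ {u} {v} e eq → proper u v e (toℕ-injective eq)))
    = f , (λ u v u≢v eq → rain u v u≢v (cong toℕ eq)) , iso

  Forces⇐ : (G : Graph (Fin m)) (H : Graph (Fin n)) → Forces′ (Graph.adj G) H → Forces G H
  Forces⇐ G H forces c proper
    with d , c⇔d ← compress c
    with f , rain , iso ← forces d (λ u v e eq → proper e (Equivalence.from (c⇔d u v) eq))
    = copy⇒subset H G c
        (f , (λ u v u≢v eq → rain u v u≢v (Equivalence.to (c⇔d (f u) (f v)) eq)) , iso)

ForcedOn? : (H : Graph (Fin n)) → Decidable (ForcedOn H)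
ForcedOn? H m = map′
  (λ (a , s , i , forces) →
    let G = record { adj = a ; ~-sym = λ {u} {v} → s u v ; ~-irrefl = λ { {u} refl → i u } }
    in G , Forces⇐ G H forces)
  (λ (G , forces) →
    Graph.adj G , (λ _ _ → Graph.~-sym G) , (λ _ → Graph.~-irrefl G refl) , Forces⇒ G H forces)
  (search-Fin→ {_≈_ = Pointwise _≡_} (λ _ → refl) (search-Fin→ {_≈_ = _≡_} refl search-Bool m) m
    (λ a≈b (s , i , forces) →
        (λ u v → subst T (a≈b v u) ∘ s u v ∘ subst T (sym (a≈b u v)))
      , (λ u → i u ∘ subst T (sym (a≈b u u)))
      , Forces′-resp H a≈b forces)
    (λ a → (all? λ u → all? λ v → T? (a u v) →-dec T? (a v u))
           ×-dec (all? λ u → ¬? (T? (a u u)))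
           ×-dec Forces′? a H))

------------------------------------------------------------------------
-- ForcedOn H holds at n * n: replace every vertex of H by an n-clique, and
-- pick colors greedily, one from each clique.

private

  avoid : (f : Fin n → ℕ) → (∀ {i j} → f i ≡ f j → i ≡ j) →
          (g : Fin l → ℕ) → l < n → ∃ λ i → ∀ j → f i ≢ g j
  avoid f f-inj g l<n with any? (λ i → all? λ j → ¬? (f i ℕ.≟ g j))
  ... | yes p = p
  ... | no ¬p = ⊥-elim (<⇒≢ i<j (f-inj (trans (h-spec i) (trans (cong g eq) (sym (h-spec j))))))
    where
    hit : ∀ i → ∃ λ j → f i ≡ g j
    hit i = decidable-stable (any? λ j → f i ℕ.≟ g j) λ ¬q → ¬p (i , λ j eq → ¬q (j , eq))
    h-spec = proj₂ ∘ hit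
    ph  = pigeonhole l<n (proj₁ ∘ hit)
    i   = proj₁ ph
    j   = proj₁ (proj₂ ph)
    i<j = proj₁ (proj₂ (proj₂ ph))
    eq  = proj₂ (proj₂ (proj₂ ph))

  greedy : (f : Fin k → Fin n → ℕ) → (∀ u {i j} → f u i ≡ f u j → i ≡ j) →
           (g : Fin l → ℕ) → k ℕ.+ l ≤ n →
           Σ (Fin k → Fin n) λ s →
             (∀ u j → f u (s u) ≢ g j) × (∀ u v → u ≢ v → f u (s u) ≢ f v (s v))
  greedy {zero} f f-inj g _ = (λ ()) , (λ ()) , λ ()
  greedy {suc k} {n} {l} f f-inj g k+l<n
    with i , i-avoids ← avoid (f zero) (f-inj zero) g (ℕ.≤-trans (s≤s (ℕ.m≤n+m l k)) k+l<n)
    with s , s-avoids , s-distinct ←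
           greedy (f ∘ suc) (λ u → f-inj (suc u)) (f zero i ∷ᶠ g)
                  (ℕ.≤-trans (ℕ.≤-reflexive (ℕ.+-suc k l)) k+l<n)
    = i ∷ᶠ s , avoids , distinct
    where
    avoids : ∀ u j → f u ((i ∷ᶠ s) u) ≢ g j
    avoids zero    j = i-avoids j
    avoids (suc u) j = s-avoids u (suc j)

    distinct : ∀ u v → u ≢ v → f u ((i ∷ᶠ s) u) ≢ f v ((i ∷ᶠ s) v)
    distinct zero    zero    u≢v = contradiction refl u≢v
    distinct zero    (suc v) _   = s-avoids v zero ∘ sym
    distinct (suc u) zero    _   = s-avoids u zero
    distinct (suc u) (suc v) u≢v = s-distinct u v (u≢v ∘ cong suc)

  pairAdj : Graph (Fin n) → Fin n × Fin n → Fin n × Fin n → Bool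
  pairAdj H (u , i) (v , j) = (⌊ u ≟ v ⌋ ∧ ⌊ ¬? (i ≟ j) ⌋) ∨ Graph.adj H u v

  pairAdj-sym : (H : Graph (Fin n)) → ∀ p q → T (pairAdj H p q) → T (pairAdj H q p)
  pairAdj-sym H (u , i) (v , j) e with u ≟ v | i ≟ j | v ≟ u | j ≟ i
  ... | yes _  | no _   | yes _  | no _   = _
  ... | yes _  | yes _  | yes _  | yes _  = Graph.~-sym H e
  ... | no _   | _      | no _   | _      = Graph.~-sym H e
  ... | yes eq | _      | no ne  | _      = contradiction (sym eq) ne
  ... | no ne  | _      | yes eq | _      = contradiction (sym eq) ne
  ... | _      | yes eq | _      | no ne  = contradiction (sym eq) ne
  ... | _      | no ne  | _      | yes eq = contradiction (sym eq) ne

  pairAdj-irrefl : (H : Graph (Fin n)) → ∀ p → ¬ T (pairAdj H p p)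
  pairAdj-irrefl H (u , i) e with u ≟ u | i ≟ i
  ... | yes _ | yes _ = Graph.~-irrefl H refl e
  ... | yes _ | no ne = ne refl
  ... | no ne | _     = ne refl

  pairAdj-clique : (H : Graph (Fin n)) → ∀ u {i j} → i ≢ j → T (pairAdj H (u , i) (u , j))
  pairAdj-clique H u {i} {j} i≢j with u ≟ u | i ≟ j
  ... | yes _ | no _   = _
  ... | yes _ | yes eq = contradiction eq i≢j
  ... | no ne | _      = contradiction refl ne

  pairAdj-copy : (H : Graph (Fin n)) (s : Fin n → Fin n) →
                 ∀ u v → Graph.adj H u v ≡ pairAdj H (u , s u) (v , s v)
  pairAdj-copy H s u v with u ≟ v
  ... | no _ = refl
  ... | yes refl with s u ≟ s u
  ...   | yes _ = refl
  ...   | no ne = contradiction refl ne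

blowUp : Graph (Fin n) → Graph (Fin (n ℕ.* n))
blowUp {n} H = record
  { adj      = λ p q → pairAdj H (remQuot n p) (remQuot n q)
  ; ~-sym    = λ {p} {q} → pairAdj-sym H (remQuot n p) (remQuot n q)
  ; ~-irrefl = λ { {p} refl → pairAdj-irrefl H (remQuot n p) }
  }

blowUp-forces : (H : Graph (Fin n)) → Forces (blowUp H) H
blowUp-forces {n} H c proper = copy⇒subset H (blowUp H) c (f , distinct , iso)
  where
  module B = Graph (blowUp H)

  adj-combine : ∀ u i v j → pairAdj H (u , i) (v , j) ≡ B.adj (combine u i) (combine v j)
  adj-combine u i v j =
    sym (cong₂ (pairAdj H) (remQuot-combine {n} {n} u i) (remQuot-combine {n} {n} v j))

  chosen = greedy {l = 0} (λ u i → c (combine u i))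
    (λ u {i} {j} eq → decidable-stable (i ≟ j) λ i≢j →
      proper (subst T (adj-combine u i u j) (pairAdj-clique H u i≢j)) eq)
    (λ ()) (ℕ.≤-reflexive (ℕ.+-identityʳ n))

  s        = proj₁ chosen
  distinct = proj₂ (proj₂ chosen)

  f : Fin n → Fin (n ℕ.* n)
  f u = combine u (s u)

  iso : ∀ u v → Graph.adj H u v ≡ B.adj (f u) (f v)
  iso u v = trans (pairAdj-copy H s u v) (adj-combine u (s u) v (s v))

------------------------------------------------------------------------

private
  search-least : {P : Pred ℕ 0ℓ} → Decidable P → ∀ m → ∃ (Least P) ⊎ (∀ j → j < m → ¬ P j)
  search-least P? zero = inj₂ λ _ ()
  search-least {P} P? (suc m) with search-least P? m
  ... | inj₁ found = inj₁ found
  ... | inj₂ none with P? m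
  ...   | yes p = inj₁ (m , p , λ j q → ℕ.≮⇒≥ λ j<m → none j j<m q)
  ...   | no ¬p = inj₂ none′
    where
    none′ : ∀ j → j < suc m → ¬ P j
    none′ j (s≤s j≤m) q with ℕ.m≤n⇒m<n∨m≡n j≤m
    ... | inj₁ j<m  = none j j<m q
    ... | inj₂ refl = ¬p q

ρ-exists : (H : Graph (Fin n)) → ∃ (Least (ForcedOn H))
ρ-exists {n} H with search-least (ForcedOn? H) (suc (n ℕ.* n))
... | inj₁ found = found
... | inj₂ none  = contradiction (blowUp H , blowUp-forces H) (none (n ℕ.* n) ℕ.≤-refl)

ρ : Graph (Fin n) → ℕ
ρ H = proj₁ (ρ-exists H)

ρ-least : (H : Graph (Fin n)) → Least (ForcedOn H) (ρ H)
ρ-least H = proj₂ (ρ-exists H)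

{-# OPTIONS --safe #-}

-- Color G greedily, each color class being a largest anticlique among the
-- vertices not yet colored.  Every nonempty anticlique S of G then contains a
-- vertex v with |S| ≤ |class of v|: take v in the first class meeting S.  For a
-- rainbow copy of H, removing such vertices one at a time from the image of an
-- anticlique of size x gives distinct color classes of sizes at least x,
-- x − 1, …, 1.  The copy being rainbow, different parts use different classes.

module Submission where

open import Level using (0ℓ)
open import Defs
open import Data.Fin using (Fin; zero; suc)
open import Data.Fin.Properties using (_≟_; any?; all?) renaming (suc-injective to Fin-suc-injective)
open import Data.Fin.Subset
  using (Subset; ∣_∣; _∈_; _∉_; _⊆_; _∩_; _─_; _-_; ⁅_⁆; ⊤; _⊂_; Nonempty; inside; outside)
open import Data.Fin.Subset.Induction using (⊂-wellFounded)
open import Induction.WellFounded using (Acc; acc)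
open import Data.Fin.Subset.Properties
open import Data.Bool using (T)
open import Data.Bool.Properties using (T?)
open import Data.Nat using (ℕ; zero; suc; _+_; _*_; _/_; _≤_; _<_; _≥_; z≤n; s≤s)
import Data.Nat.Properties as ℕ
open import Data.Nat.Properties using (+-0-commutativeMonoid)
open import Data.Nat.Divisibility using (divides-refl)
open import Data.Nat.DivMod using (m*n/n≡m; +-distrib-/-∣ʳ)
open import Data.Nat.Tactic.RingSolver using (solve-∀)
open import Data.Product using (∃; _×_; _,_; proj₁; proj₂)
open import Data.Vec using ([]; _∷_; here; there; tabulate)
open import Data.Vec.Properties using (lookup∘tabulate; []=⇒lookup; lookup⇒[]=)
open import Function using (_∘_; id)
open import Relation.Nullary using (yes; no; does; ¬?; contradiction; _×-dec_; _→-dec_)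
open import Relation.Nullary.Decidable using (map′; decidable-stable; dec-true)
open import Relation.Unary using (Pred; Decidable)
open import Algebra.Properties.CommutativeMonoid.Sum +-0-commutativeMonoid using (sum-syntax)
open import Relation.Binary.PropositionalEquality
  using (_≡_; _≢_; refl; sym; trans; cong; subst; module ≡-Reasoning)

private
  variable
    k m n : ℕ
    p : Subset n
    x : Fin n

-- Sizes of finite subsets

x∈p─q⇒x∉q : ∀ (p q : Subset n) → x ∈ p ─ q → x ∉ q
x∈p─q⇒x∉q (_ ∷ p) (outside ∷ q) (there x∈) (there x∈q) = x∈p─q⇒x∉q p q x∈ x∈q
x∈p─q⇒x∉q (_ ∷ p) (inside  ∷ q) (there x∈) (there x∈q) = x∈p─q⇒x∉q p q x∈ x∈q

∣q∣+∣p─q∣≡∣p∣ : ∀ (p q : Subset n) → q ⊆ p → ∣ q ∣ + ∣ p ─ q ∣ ≡ ∣ p ∣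
∣q∣+∣p─q∣≡∣p∣ []            []            _   = refl
∣q∣+∣p─q∣≡∣p∣ (inside  ∷ p) (inside  ∷ q) q⊆p = cong suc (∣q∣+∣p─q∣≡∣p∣ p q (drop-∷-⊆ q⊆p))
∣q∣+∣p─q∣≡∣p∣ (inside  ∷ p) (outside ∷ q) q⊆p =
  trans (ℕ.+-suc ∣ q ∣ ∣ p ─ q ∣) (cong suc (∣q∣+∣p─q∣≡∣p∣ p q (drop-∷-⊆ q⊆p)))
∣q∣+∣p─q∣≡∣p∣ (outside ∷ p) (inside  ∷ q) q⊆p = contradiction (q⊆p here) λ ()
∣q∣+∣p─q∣≡∣p∣ (outside ∷ p) (outside ∷ q) q⊆p = ∣q∣+∣p─q∣≡∣p∣ p q (drop-∷-⊆ q⊆p)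

x∈p⇒⁅x⁆⊆p : x ∈ p → ⁅ x ⁆ ⊆ p
x∈p⇒⁅x⁆⊆p {x = x} {p} x∈p y∈ = subst (_∈ p) (sym (x∈⁅y⁆⇒x≡y x y∈)) x∈p

suc∣p-x∣≡∣p∣ : ∀ {p : Subset n} → x ∈ p → suc ∣ p - x ∣ ≡ ∣ p ∣
suc∣p-x∣≡∣p∣ {x = x} {p} x∈p =
  trans (cong (_+ ∣ p - x ∣) (sym (∣⁅x⁆∣≡1 x)))
        (∣q∣+∣p─q∣≡∣p∣ p ⁅ x ⁆ (x∈p⇒⁅x⁆⊆p x∈p))

0<∣p∣⇒nonempty : ∀ (p : Subset n) → 0 < ∣ p ∣ → Nonempty p
0<∣p∣⇒nonempty (inside  ∷ p) _     = zero , here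
0<∣p∣⇒nonempty (outside ∷ p) 0<∣p∣ with y , y∈p ← 0<∣p∣⇒nonempty p 0<∣p∣ = suc y , there y∈p

-- Induction along `p`: when `zero` lies in `p`, its image is removed from `q`, and injectivity
-- keeps the images of the later elements away from it.
injection⇒∣p∣≤∣q∣ : (f : Fin n → Fin m) → (∀ {u v} → f u ≡ f v → u ≡ v) →
                    ∀ p q → (∀ {u} → u ∈ p → f u ∈ q) → ∣ p ∣ ≤ ∣ q ∣
injection⇒∣p∣≤∣q∣ f f-inj []            q f-into = z≤n
injection⇒∣p∣≤∣q∣ f f-inj (outside ∷ p) q f-into =
  injection⇒∣p∣≤∣q∣ (f ∘ suc) (Fin-suc-injective ∘ f-inj) p q (f-into ∘ there)
injection⇒∣p∣≤∣q∣ f f-inj (inside  ∷ p) q f-into =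
  ℕ.≤-trans
    (s≤s (injection⇒∣p∣≤∣q∣ (f ∘ suc) (Fin-suc-injective ∘ f-inj) p (q - f zero)
      λ u∈p → x∈p∧x≢y⇒x∈p-y (f-into (there u∈p)) λ eq → contradiction (f-inj eq) λ ()))
    (ℕ.≤-reflexive (suc∣p-x∣≡∣p∣ (f-into here)))

module _ {P : Pred (Fin n) 0ℓ} (P? : Decidable P) where

  comprehension : Subset n
  comprehension = tabulate (does ∘ P?)

  ∈-comprehension⁺ : P x → x ∈ comprehension
  ∈-comprehension⁺ {x} Px =
    lookup⇒[]= x comprehension (trans (lookup∘tabulate (does ∘ P?) x) (dec-true (P? x) Px))

  ∈-comprehension⁻ : x ∈ comprehension → P x
  ∈-comprehension⁻ {x} x∈ with P? x | trans (sym (lookup∘tabulate (does ∘ P?) x)) ([]=⇒lookup x∈)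
  ... | yes Px | _ = Px

-- An upper bound on the sizes is lowered from `n` until some set satisfying `P` attains it.
largest : {P : Pred (Subset n) 0ℓ} → Decidable P → ∃ P →
          ∃ λ M → P M × (∀ S → P S → ∣ S ∣ ≤ ∣ M ∣)
largest {n} {P} P? (S₀ , PS₀) = below n λ S _ → ∣p∣≤n S
  where
  below : ∀ b → (∀ S → P S → ∣ S ∣ ≤ b) → ∃ λ M → P M × (∀ S → P S → ∣ S ∣ ≤ ∣ M ∣)
  below b bound with anySubset? (λ S → P? S ×-dec (∣ S ∣ ℕ.≟ b))
  ... | yes (M , PM , refl) = M , PM , bound
  -- A bound of 0 is attained by `S₀`, so the search cannot run past it.
  below zero    bound | no ¬∃ = contradiction (S₀ , PS₀ , ℕ.n≤0⇒n≡0 (bound S₀ PS₀)) ¬∃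
  below (suc b) bound | no ¬∃ = below b λ S PS →
    ℕ.≤-pred (ℕ.≤∧≢⇒< (bound S PS) λ eq → ¬∃ (S , PS , eq))

-- Cut `F zero` out of `W`: by disjointness the remaining sets still fit into what is left, and the
-- sizes of the two pieces of `W` add up.
sum-disjoint≤ : (F : Fin k → Subset m) (t : Fin k → ℕ) (W : Subset m) →
                (∀ i → F i ⊆ W) → (∀ {i j u} → u ∈ F i → u ∈ F j → i ≡ j) →
                (∀ i → t i ≤ ∣ F i ∣) → ∑[ i < k ] t i ≤ ∣ W ∣
sum-disjoint≤ {zero}  F t W F⊆W disjoint t≤ = z≤n
sum-disjoint≤ {suc k} F t W F⊆W disjoint t≤ =
  ℕ.≤-trans
    (ℕ.+-mono-≤ (t≤ zero)
      (sum-disjoint≤ (F ∘ suc) (t ∘ suc) (W ─ F zero)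
        (λ i u∈ → x∈p∧x∉q⇒x∈p─q (F⊆W (suc i) u∈) λ u∈F₀ → contradiction (disjoint u∈F₀ u∈) λ ())
        (λ u∈ u∈′ → Fin-suc-injective (disjoint u∈ u∈′))
        (t≤ ∘ suc)))
    (ℕ.≤-reflexive (∣q∣+∣p─q∣≡∣p∣ W (F zero) (F⊆W zero)))

-- Triangular numbers from disjoint large sets

triangle-suc : ∀ s → suc s * (suc s + 1) / 2 ≡ suc s + s * (s + 1) / 2
triangle-suc s = begin
  suc s * (suc s + 1) / 2           ≡⟨ cong (_/ 2) (expand s) ⟩
  -- Truncating division distributes over this sum because the second summand is a multiple of 2.
  (s * (s + 1) + suc s * 2) / 2     ≡⟨ +-distrib-/-∣ʳ (s * (s + 1)) (divides-refl (suc s)) ⟩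
  s * (s + 1) / 2 + suc s * 2 / 2   ≡⟨ cong (s * (s + 1) / 2 +_) (m*n/n≡m (suc s) 2) ⟩
  s * (s + 1) / 2 + suc s           ≡⟨ ℕ.+-comm (s * (s + 1) / 2) (suc s) ⟩
  suc s + s * (s + 1) / 2           ∎
  where
  open ≡-Reasoning
  expand : ∀ s → suc s * (suc s + 1) ≡ s * (s + 1) + suc s * 2
  expand = solve-∀

-- The largeness hypothesis, applied to `A` itself, yields `v` with `F v` of size at least `s`.
-- Deleting `v` from `A` and `F v` from `W` leaves the same situation with `s` one smaller, since
-- the hypothesis speaks of all nonempty subsets of `A` and so passes to `A - v`.
triangle≤ : (F : Fin n → Subset m) → (∀ {v w u} → u ∈ F v → u ∈ F w → v ≡ w) →
            ∀ s A W → ∣ A ∣ ≡ s → (∀ {v} → v ∈ A → F v ⊆ W) →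
            (∀ S → S ⊆ A → Nonempty S → ∃ λ v → v ∈ S × ∣ S ∣ ≤ ∣ F v ∣) →
            s * (s + 1) / 2 ≤ ∣ W ∣
triangle≤ F disjoint zero    A W _   _   _     = z≤n
triangle≤ F disjoint (suc s) A W ∣A∣ F⊆W large
  with v , v∈A , A≤Fv ← large A id (0<∣p∣⇒nonempty A (subst (0 <_) (sym ∣A∣) (s≤s z≤n))) = begin
    suc s * (suc s + 1) / 2   ≡⟨ triangle-suc s ⟩
    suc s + s * (s + 1) / 2   ≤⟨ ℕ.+-mono-≤ (subst (_≤ ∣ F v ∣) ∣A∣ A≤Fv) rest ⟩
    ∣ F v ∣ + ∣ W ─ F v ∣     ≡⟨ ∣q∣+∣p─q∣≡∣p∣ W (F v) (F⊆W v∈A) ⟩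
    ∣ W ∣                     ∎
  where
  open ℕ.≤-Reasoning
  A-v⊆A : A - v ⊆ A
  A-v⊆A = p─q⊆p A ⁅ v ⁆

  rest : s * (s + 1) / 2 ≤ ∣ W ─ F v ∣
  rest = triangle≤ F disjoint s (A - v) (W ─ F v)
    (ℕ.suc-injective (trans (suc∣p-x∣≡∣p∣ v∈A) ∣A∣))
    (λ w∈ u∈Fw → x∈p∧x∉q⇒x∈p─q (F⊆W (A-v⊆A w∈) u∈Fw)
      -- A point common to `F v` and `F w` would give `v ≡ w`, but `w` was taken from `A - v`.
      λ u∈Fv → x∈p─q⇒x∉q A ⁅ v ⁆ w∈ (subst (_∈ ⁅ v ⁆) (disjoint u∈Fv u∈Fw) (x∈⁅x⁆ v)))
    (λ S S⊆ → large S (A-v⊆A ∘ S⊆))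

-- Greedy coloring by largest anticliques

colorClass : (Fin m → ℕ) → ℕ → Subset m
colorClass c a = comprehension λ u → c u ℕ.≟ a

∈-colorClass⁺ : ∀ (c : Fin m → ℕ) {a u} → c u ≡ a → u ∈ colorClass c a
∈-colorClass⁺ c {a} = ∈-comprehension⁺ λ u → c u ℕ.≟ a

∈-colorClass⁻ : ∀ (c : Fin m → ℕ) {a u} → u ∈ colorClass c a → c u ≡ a
∈-colorClass⁻ c {a} = ∈-comprehension⁻ λ u → c u ℕ.≟ a

-- Shifting the old colors by one frees color 0 for the new class `M`.
extend : (M : Subset m) → (Fin m → ℕ) → Fin m → ℕ
extend M c u with u ∈? M
... | yes _ = 0
... | no  _ = suc (c u)

extend-∈ : ∀ {M : Subset m} {c u} → u ∈ M → extend M c u ≡ 0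
extend-∈ {M = M} {u = u} u∈M with u ∈? M
... | yes _  = refl
... | no u∉M = contradiction u∈M u∉M

extend-∉ : ∀ {M : Subset m} {c u} → u ∉ M → extend M c u ≡ suc (c u)
extend-∉ {M = M} {u = u} u∉M with u ∈? M
... | yes u∈M = contradiction u∈M u∉M
... | no _    = refl

module _ (G : Graph (Fin m)) where

  open Graph G

  anticlique? : Decidable (Anticlique G)
  anticlique? S = map′ (λ f {u} {v} → f u v) (λ f u v → f)
    (all? λ u → all? λ v → (u ∈? S) →-dec (v ∈? S) →-dec ¬? (T? (adj u v)))

  singleton-anticlique : ∀ v → Anticlique G ⁅ v ⁆
  singleton-anticlique v x∈ y∈ = ~-irrefl (trans (x∈⁅y⁆⇒x≡y v x∈) (sym (x∈⁅y⁆⇒x≡y v y∈)))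

  -- The invariant of the greedy procedure on the part `R` of the vertex set. The values of `c`
  -- outside `R` are arbitrary, so color classes are measured inside `R` only.
  Greedy : Subset m → (Fin m → ℕ) → Set
  Greedy R c = (∀ {u v} → u ∈ R → v ∈ R → u ~ v → c u ≢ c v)
             × (∀ S → S ⊆ R → Nonempty S → Anticlique G S →
                ∃ λ v → v ∈ S × ∣ S ∣ ≤ ∣ R ∩ colorClass c (c v) ∣)

  -- An anticlique that meets `M` is no larger than `M`, and `M` lies in the class of any common
  -- vertex. One that misses `M` lies in `R ─ M`, where the old coloring already provides a vertex,
  -- and the shift keeps old classes together.
  extend-greedy : ∀ {R M c} → M ⊆ R → Anticlique G M →
                  (∀ S → S ⊆ R × Anticlique G S → ∣ S ∣ ≤ ∣ M ∣) →
                  Greedy (R ─ M) c → Greedy R (extend M c)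
  extend-greedy {R} {M} {c} M⊆R antiM M-largest (proper , large) = proper′ , large′
    where
    proper′ : ∀ {u v} → u ∈ R → v ∈ R → u ~ v → extend M c u ≢ extend M c v
    proper′ {u} {v} u∈R v∈R u~v with u ∈? M | v ∈? M
    ... | yes u∈M | yes v∈M = contradiction u~v (antiM u∈M v∈M)
    ... | yes _   | no _    = λ ()
    ... | no _    | yes _   = λ ()
    ... | no u∉M  | no v∉M  =
      proper (x∈p∧x∉q⇒x∈p─q u∈R u∉M) (x∈p∧x∉q⇒x∈p─q v∈R v∉M) u~v ∘ ℕ.suc-injective

    c′ = extend M c

    large′ : ∀ S → S ⊆ R → Nonempty S → Anticlique G S →
             ∃ λ v → v ∈ S × ∣ S ∣ ≤ ∣ R ∩ colorClass c′ (c′ v) ∣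
    large′ S S⊆R S≢∅ antiS with nonempty? (S ∩ M)
    ... | yes (v , v∈S∩M) = v , v∈S , ℕ.≤-trans (M-largest S (S⊆R , antiS)) (p⊆q⇒∣p∣≤∣q∣ M⊆class)
      where
      v∈S = proj₁ (x∈p∩q⁻ S M v∈S∩M)
      v∈M = proj₂ (x∈p∩q⁻ S M v∈S∩M)

      M⊆class : M ⊆ R ∩ colorClass c′ (c′ v)
      M⊆class u∈M =
        x∈p∩q⁺ (M⊆R u∈M , ∈-colorClass⁺ c′ (trans (extend-∈ u∈M) (sym (extend-∈ v∈M))))
    ... | no S∩M≡∅
      with v , v∈S , S≤ ← large S (λ u∈S → x∈p∧x∉q⇒x∈p─q (S⊆R u∈S)
                                     λ u∈M → S∩M≡∅ (_ , x∈p∩q⁺ (u∈S , u∈M))) S≢∅ antiS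
      = v , v∈S , ℕ.≤-trans S≤ (p⊆q⇒∣p∣≤∣q∣ class⊆class′)
      where
      class⊆class′ : (R ─ M) ∩ colorClass c (c v) ⊆ R ∩ colorClass c′ (c′ v)
      class⊆class′ u∈ with u∈R─M , u∈class ← x∈p∩q⁻ (R ─ M) (colorClass c (c v)) u∈ =
        x∈p∩q⁺ (p─q⊆p R M u∈R─M , ∈-colorClass⁺ c′
          (trans (extend-∉ (x∈p─q⇒x∉q R M u∈R─M))
          (trans (cong suc (∈-colorClass⁻ c u∈class))
                 (sym (extend-∉ λ v∈M → S∩M≡∅ (v , x∈p∩q⁺ (v∈S , v∈M)))))))

  greedy : ∀ R → ∃ (Greedy R)
  greedy R = go R (⊂-wellFounded R)
    where
    go : ∀ R → Acc _⊂_ R → ∃ (Greedy R)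
    go R (acc rec) with nonempty? R
    -- Nothing is left to color, so any default color serves.
    ... | no R≡∅ = (λ _ → 0) ,
      (λ u∈R → contradiction (_ , u∈R) R≡∅) ,
      (λ S S⊆R (u , u∈S) → contradiction (u , S⊆R u∈S) R≡∅)
    ... | yes (r , r∈R) =
      let M , (M⊆R , antiM) , M-largest =
            largest (λ S → (S ⊆? R) ×-dec anticlique? S) (⁅ r ⁆ , x∈p⇒⁅x⁆⊆p r∈R , singleton-anticlique r)
          -- `M` is at least as large as the anticlique `⁅ r ⁆`, hence nonempty, which makes `R ─ M`
          -- strictly smaller than `R`.
          v , v∈M = 0<∣p∣⇒nonempty M (subst (_≤ ∣ M ∣) (∣⁅x⁆∣≡1 r)
                      (M-largest ⁅ r ⁆ (x∈p⇒⁅x⁆⊆p r∈R , singleton-anticlique r)))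
          c , c-greedy = go (R ─ M) (rec (p∩q≢∅⇒p─q⊂p R M (v , x∈p∩q⁺ (M⊆R v∈M , v∈M))))
      in extend M c , extend-greedy M⊆R antiM M-largest c-greedy

coloring-with-large-classes :
  (G : Graph (Fin m)) → ∃ λ c → Proper G c ×
    (∀ S → Nonempty S → Anticlique G S → ∃ λ v → v ∈ S × ∣ S ∣ ≤ ∣ colorClass c (c v) ∣)
coloring-with-large-classes G with c , proper , large ← greedy G ⊤ =
  c , proper ∈⊤ ∈⊤ , λ S S≢∅ antiS →
    let v , v∈S , S≤ = large S ⊆⊤ S≢∅ antiS
    in v , v∈S , ℕ.≤-trans S≤ (∣p∩q∣≤∣q∣ ⊤ (colorClass c (c v)))

-- Color classes met by a rainbow copy

-- The image of `S` under `f` is an anticlique of `G`, because a copy reflects adjacency, and it is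
-- at least as large as `S`, because a rainbow copy is injective. The vertex found in the image is
-- pulled back to `S`.
large-class-in-copy :
  (H : Graph (Fin n)) (G : Graph (Fin m)) {c : Fin m → ℕ} {f : Fin n → Fin m} →
  Copy H (Graph.adj G) c f →
  (∀ S → Nonempty S → Anticlique G S → ∃ λ v → v ∈ S × ∣ S ∣ ≤ ∣ colorClass c (c v) ∣) →
  ∀ S → Nonempty S → Anticlique H S → ∃ λ v → v ∈ S × ∣ S ∣ ≤ ∣ colorClass c (c (f v)) ∣
large-class-in-copy H G {c} {f} (rain , iso) large S (s , s∈S) antiS =
  let _ , w∈fS , fS≤ = large fS (f s , ∈fS s∈S) antifS
      v , v∈S , fv≡w = fS⁻ w∈fS
  in v , v∈S , ℕ.≤-trans (injection⇒∣p∣≤∣q∣ f f-inj S fS ∈fS)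
                 (subst (λ w → ∣ fS ∣ ≤ ∣ colorClass c (c w) ∣) (sym fv≡w) fS≤)
  where
  f-inj : ∀ {u v} → f u ≡ f v → u ≡ v
  f-inj {u} {v} eq = decidable-stable (u ≟ v) λ u≢v → rain u v u≢v (cong c eq)

  inImage? : Decidable λ w → ∃ λ v → v ∈ S × f v ≡ w
  inImage? w = any? λ v → (v ∈? S) ×-dec (f v ≟ w)

  fS = comprehension inImage?

  ∈fS : ∀ {v} → v ∈ S → f v ∈ fS
  ∈fS v∈S = ∈-comprehension⁺ inImage? (_ , v∈S , refl)

  fS⁻ : ∀ {w} → w ∈ fS → ∃ λ v → v ∈ S × f v ≡ w
  fS⁻ = ∈-comprehension⁻ inImage?

  antifS : Anticlique G fS
  antifS u∈ v∈ u~v with x , x∈S , refl ← fS⁻ u∈ | y , y∈S , refl ← fS⁻ v∈ =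
    antiS x∈S y∈S (subst T (sym (iso x y)) u~v)

-- The vertices of `G` are split according to which part of `H` their color belongs to. In a rainbow
-- copy a color determines at most one vertex of `H`, hence at most one part, so the contributions
-- of the parts are disjoint and add up to at most `m`.
forces⇒triangles≤ :
  (H : Graph (Fin n)) (G : Graph (Fin m)) → Forces G H →
  (P : Fin k → Subset n) (x : Fin k → ℕ) →
  Partition P → (∀ i → Anticlique H (P i)) → (∀ i → ∣ P i ∣ ≡ x i) →
  ∑[ i < k ] (x i * (x i + 1) / 2) ≤ m
forces⇒triangles≤ {n} {m} {k} H G forces P x partition anti ∣P∣≡x
  with c , proper , large ← coloring-with-large-classes G
  with f , copy@(rain , _) ← subset⇒copy H G c (forces c proper) =
  ℕ.≤-trans (sum-disjoint≤ U (λ i → x i * (x i + 1) / 2) ⊤ (λ _ → ⊆⊤) U-disjoint triangle≤U)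
            (ℕ.≤-reflexive (∣⊤∣≡n (m)))
  where
  F : Fin n → Subset (m)
  F v = colorClass c (c (f v))

  f-rainbow : ∀ {v w a} → a ≡ c (f v) → a ≡ c (f w) → v ≡ w
  f-rainbow {v} {w} eq eq′ =
    decidable-stable (v ≟ w) λ v≢w → rain v w v≢w (trans (sym eq) eq′)

  inUnion? : ∀ i → Decidable λ u → ∃ λ v → v ∈ P i × c u ≡ c (f v)
  inUnion? i u = any? λ v → (v ∈? P i) ×-dec (c u ℕ.≟ c (f v))

  -- The union of the full color classes in `G` of the images of the vertices of `P i`.
  U : Fin k → Subset (m)
  U i = comprehension (inUnion? i)

  P-disjoint : ∀ {i j v} → v ∈ P i → v ∈ P j → i ≡ j
  P-disjoint {v = v} v∈Pi v∈Pj with _ , _ , unique ← partition v =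
    trans (sym (unique v∈Pi)) (unique v∈Pj)

  U-disjoint : ∀ {i j u} → u ∈ U i → u ∈ U j → i ≡ j
  U-disjoint {i} {j} u∈Ui u∈Uj
    with v , v∈Pi , eq ← ∈-comprehension⁻ (inUnion? i) u∈Ui
       | w , w∈Pj , eq′ ← ∈-comprehension⁻ (inUnion? j) u∈Uj
    = P-disjoint v∈Pi (subst (_∈ P j) (sym (f-rainbow eq eq′)) w∈Pj)

  triangle≤U : ∀ i → x i * (x i + 1) / 2 ≤ ∣ U i ∣
  triangle≤U i = triangle≤ F
    (λ u∈Fv u∈Fw → f-rainbow (∈-colorClass⁻ c u∈Fv) (∈-colorClass⁻ c u∈Fw))
    (x i) (P i) (U i) (∣P∣≡x i)
    (λ v∈Pi u∈Fv → ∈-comprehension⁺ (inUnion? i) (_ , v∈Pi , ∈-colorClass⁻ c u∈Fv))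
    (λ S S⊆Pi S≢∅ → large-class-in-copy H G {c} {f} copy large S S≢∅
      λ u∈S v∈S → anti i (S⊆Pi u∈S) (S⊆Pi v∈S))

theorem2p1 : ∀ {n k : ℕ} (H : Graph (Fin n)) (P : Fin k → Subset n) (x : Fin k → ℕ) →
    Partition P → (∀ i → Anticlique H (P i)) → (∀ i → ∣ P i ∣ ≡ x i) →
    ρ H ≥ ∑[ i < k ] ((x i * (x i + 1)) / 2)
theorem2p1 H =
  -- `ρ H` is attained: some graph `G` on exactly `ρ H` vertices forces `H`, and the bound applies
  -- to it.
  let (G , forces) , _ = ρ-least H in forces⇒triangles≤ H G forces
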